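{- Let $C\subset[0,1]$ be the usual middle-third Cantor set and let $\mathbf{BA}(1,1)\subset\mathbb{R}$ be the set of badly approximable numbers. For Schmidt's game played on $C$, $$\operatorname{Windim}(C\cap\mathbf{BA}(1,1))\le\tfrac13 .$$
   Context: **Badly approximable numbers.** $A\in\mathbb{R}$ is badly approximable if there is $c>0$ such that the distance from $Ax$ to the nearest integer is $>c|x|^{ -1}$ for every nonzero integer $x$. **Schmidt's game on a compact set $\mathcal{K}\subset\mathbb{R}^n$.** Fix $0<\alpha,\beta<1$ and a target set $\mathcal{S}\subset\mathcal{K}$. All balls are closed Euclidean balls of $\mathbb{R}^n$ with centers in $\mathcal{K}$, and containments are between balls of $\mathbb{R}^n$. Player Black first chooses a ball $U(0)$ of some radius $\rho>0$ (with $\rho\le\operatorname{diam}\mathcal{K}$, a convention costing no generality). Given Black's ball $U(k)$, White chooses a ball $W(k)\subset U(k)$ with radius $\alpha$ times that of $U(k)$; then Black chooses a ball $U(k+1)\subset W(k)$ with radius $\beta$ times that of $W(k)$; and so on. White wins if the unique point of $\bigcap_k U(k)$ lies in $\mathcal{S}$; otherwise Black wins. $\mathcal{S}$ is $(\alpha,\beta)$-winning if White has a winning strategy, and $\alpha$-winning if it is $(\alpha,\beta)$-winning for all $\beta\in(0,1)$. Here $n=1$ and $\mathcal{K}=C$. **Winning dimension.** $\operatorname{Windim}(\mathcal{S})=0$ if $\mathcal{S}$ is $\alpha$-winning for no $\alpha>0$; otherwise $\operatorname{Windim}(\mathcal{S})$ is the least upper bound of all $0<\alpha<1$ such that $\mathcal{S}$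 is $\alpha$-winning. -}

module Defs where

open import Data.Fin.Base using (toℕ)
open import Data.Integer.Base as ℤ using (ℤ)
open import Data.Nat.Base as ℕ using (ℕ; zero; suc)
import Data.Nat.Properties as ℕₚ
open import Data.Product.Base using (∃-syntax; _×_; _,_)
open import Data.Rational.Base as ℚ using (ℚ; 0ℚ; 1ℚ; ½)
import Data.Rational.Properties as ℚₚ
open import Data.Sum.Base using (_⊎_; inj₁; inj₂)
open import Data.Vec.Base using (Vec; tabulate)
open import Function.Base using (_∘_)
open import Level using (0ℓ)
open import Relation.Binary.PropositionalEquality
  using (_≡_; sym; trans; cong; subst; subst₂)
open import Relation.Nullary.Decidable.Core using (dec⇒maybe)
open import Relation.Nullary.Negation using (¬_)
open import Relation.Unary using (Pred; _∈_; _⊆_)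
open import Tactic.RingSolver using (solve-∀)
open import Tactic.RingSolver.Core.AlmostCommutativeRing
  using (AlmostCommutativeRing; fromCommutativeRing)

------------------------------------------------------------------------
-- Rational estimates

private
  ℚ-ring : AlmostCommutativeRing 0ℓ 0ℓ
  ℚ-ring = fromCommutativeRing ℚₚ.+-*-commutativeRing (λ q → dec⇒maybe (0ℚ ℚₚ.≟ q))

  +-sub-distrib : ∀ a b c d → (a ℚ.+ b) ℚ.- (c ℚ.+ d) ≡ (a ℚ.- c) ℚ.+ (b ℚ.- d)
  +-sub-distrib = solve-∀ ℚ-ring

  neg-sub-neg : ∀ a b → (ℚ.- a) ℚ.- (ℚ.- b) ≡ ℚ.- (a ℚ.- b)
  neg-sub-neg = solve-∀ ℚ-ring

  neg-sub : ∀ a b → ℚ.- (a ℚ.- b) ≡ b ℚ.- a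
  neg-sub = solve-∀ ℚ-ring

  sub-add-cancel : ∀ a b → (a ℚ.- b) ℚ.+ b ≡ a
  sub-add-cancel = solve-∀ ℚ-ring

  add-sub-cancel : ∀ a b → (a ℚ.+ b) ℚ.- b ≡ a
  add-sub-cancel = solve-∀ ℚ-ring

  product-sub : ∀ a b c d →
    (a ℚ.* b) ℚ.- (c ℚ.* d) ≡ a ℚ.* (b ℚ.- d) ℚ.+ d ℚ.* (a ℚ.- c)
  product-sub = solve-∀ ℚ-ring

  halves : ∀ ε → ε ℚ.* ½ ℚ.+ ε ℚ.* ½ ≡ ε
  halves ε = trans (sym (ℚₚ.*-distribˡ-+ ε ½ ½)) (ℚₚ.*-identityʳ ε)

  *-pos : ∀ {p q} → 0ℚ ℚ.< p → 0ℚ ℚ.< q → 0ℚ ℚ.< p ℚ.* q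
  *-pos {p} {q} 0<p 0<q =
    subst (ℚ._< p ℚ.* q) (ℚₚ.*-zeroʳ p)
      (ℚₚ.*-monoʳ-<-pos p {{ℚ.positive 0<p}} 0<q)

  half-pos : ∀ {ε} → 0ℚ ℚ.< ε → 0ℚ ℚ.< ε ℚ.* ½
  half-pos 0<ε = *-pos 0<ε (ℚₚ.positive⁻¹ ½)

  ∣-∣-sub-comm : ∀ p q → ℚ.∣ p ℚ.- q ∣ ≡ ℚ.∣ q ℚ.- p ∣
  ∣-∣-sub-comm p q =
    trans (sym (ℚₚ.∣-p∣≡∣p∣ (p ℚ.- q))) (cong ℚ.∣_∣ (neg-sub p q))

  ∣p∣≤∣p-q∣+∣q∣ : ∀ p q → ℚ.∣ p ∣ ℚ.≤ ℚ.∣ p ℚ.- q ∣ ℚ.+ ℚ.∣ q ∣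
  ∣p∣≤∣p-q∣+∣q∣ p q =
    subst (λ r → ℚ.∣ r ∣ ℚ.≤ ℚ.∣ p ℚ.- q ∣ ℚ.+ ℚ.∣ q ∣) (sub-add-cancel p q)
      (ℚₚ.∣p+q∣≤∣p∣+∣q∣ (p ℚ.- q) q)

  ∣p∣-∣q∣≤∣p-q∣ : ∀ p q → ℚ.∣ p ∣ ℚ.- ℚ.∣ q ∣ ℚ.≤ ℚ.∣ p ℚ.- q ∣
  ∣p∣-∣q∣≤∣p-q∣ p q =
    subst (ℚ.∣ p ∣ ℚ.- ℚ.∣ q ∣ ℚ.≤_) (add-sub-cancel ℚ.∣ p ℚ.- q ∣ ℚ.∣ q ∣)
      (ℚₚ.+-monoˡ-≤ (ℚ.- ℚ.∣ q ∣) (∣p∣≤∣p-q∣+∣q∣ p q))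

  ∣∣p∣-∣q∣∣≤∣p-q∣ : ∀ p q → ℚ.∣ ℚ.∣ p ∣ ℚ.- ℚ.∣ q ∣ ∣ ℚ.≤ ℚ.∣ p ℚ.- q ∣
  ∣∣p∣-∣q∣∣≤∣p-q∣ p q with ℚₚ.∣p∣≡p∨∣p∣≡-p (ℚ.∣ p ∣ ℚ.- ℚ.∣ q ∣)
  ... | inj₁ eq = subst (ℚ._≤ ℚ.∣ p ℚ.- q ∣) (sym eq) (∣p∣-∣q∣≤∣p-q∣ p q)
  ... | inj₂ eq = subst₂ ℚ._≤_
    (sym (trans eq (neg-sub ℚ.∣ p ∣ ℚ.∣ q ∣))) (∣-∣-sub-comm q p)
    (∣p∣-∣q∣≤∣p-q∣ q p)

  ∣p*q∣<b*δ : ∀ {p q b δ} → 0ℚ ℚ.< b → ℚ.∣ p ∣ ℚ.≤ b → ℚ.∣ q ∣ ℚ.< δ →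
              ℚ.∣ p ℚ.* q ∣ ℚ.< b ℚ.* δ
  ∣p*q∣<b*δ {p} {q} {b} {δ} 0<b p≤b q<δ = begin-strict
    ℚ.∣ p ℚ.* q ∣          ≡⟨ ℚₚ.∣p*q∣≡∣p∣*∣q∣ p q ⟩
    ℚ.∣ p ∣ ℚ.* ℚ.∣ q ∣
      ≤⟨ ℚₚ.*-monoʳ-≤-nonNeg ℚ.∣ q ∣ {{ℚₚ.∣-∣-nonNeg q}} p≤b ⟩
    b ℚ.* ℚ.∣ q ∣          <⟨ ℚₚ.*-monoʳ-<-pos b {{ℚ.positive 0<b}} q<δ ⟩
    b ℚ.* δ                ∎
    where open ℚₚ.≤-Reasoning

  ∣x*y-u*v∣<a*δ+b*δ : ∀ x y u v {a b δ} → 0ℚ ℚ.< a → 0ℚ ℚ.< b →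
    ℚ.∣ x ∣ ℚ.≤ a → ℚ.∣ v ∣ ℚ.≤ b →
    ℚ.∣ y ℚ.- v ∣ ℚ.< δ → ℚ.∣ x ℚ.- u ∣ ℚ.< δ →
    ℚ.∣ x ℚ.* y ℚ.- u ℚ.* v ∣ ℚ.< a ℚ.* δ ℚ.+ b ℚ.* δ
  ∣x*y-u*v∣<a*δ+b*δ x y u v {a} {b} {δ} 0<a 0<b x≤a v≤b y-v<δ x-u<δ = begin-strict
    ℚ.∣ x ℚ.* y ℚ.- u ℚ.* v ∣
      ≡⟨ cong ℚ.∣_∣ (product-sub x y u v) ⟩
    ℚ.∣ x ℚ.* (y ℚ.- v) ℚ.+ v ℚ.* (x ℚ.- u) ∣
      ≤⟨ ℚₚ.∣p+q∣≤∣p∣+∣q∣ (x ℚ.* (y ℚ.- v)) (v ℚ.* (x ℚ.- u)) ⟩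
    ℚ.∣ x ℚ.* (y ℚ.- v) ∣ ℚ.+ ℚ.∣ v ℚ.* (x ℚ.- u) ∣
      <⟨ ℚₚ.+-mono-< (∣p*q∣<b*δ {x} {y ℚ.- v} 0<a x≤a y-v<δ)
                     (∣p*q∣<b*δ {v} {x ℚ.- u} 0<b v≤b x-u<δ) ⟩
    a ℚ.* δ ℚ.+ b ℚ.* δ ∎
    where open ℚₚ.≤-Reasoning

  divide : ∀ s ε → 0ℚ ℚ.< s → 0ℚ ℚ.< ε → ∃[ δ ] (0ℚ ℚ.< δ × s ℚ.* δ ≡ ε)
  divide s ε 0<s 0<ε = s⁻¹ ℚ.* ε
    , *-pos (ℚₚ.positive⁻¹ s⁻¹ {{ℚₚ.1/pos⇒pos s}}) 0<ε
    , trans (sym (ℚₚ.*-assoc s s⁻¹ ε))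
        (trans (cong (ℚ._* ε) (ℚₚ.*-inverseʳ s)) (ℚₚ.*-identityˡ ε))
    where
    instance
      s-positive : ℚ.Positive s
      s-positive = ℚ.positive 0<s
      s-nonZero : ℚ.NonZero s
      s-nonZero = ℚₚ.pos⇒nonZero s
    s⁻¹ : ℚ
    s⁻¹ = ℚ.1/ s

------------------------------------------------------------------------
-- Real numbers, as Cauchy sequences of rationals up to _≈_

IsCauchy : (ℕ → ℚ) → Set
IsCauchy x = ∀ ε → 0ℚ ℚ.< ε →
  ∃[ N ] (∀ m n → N ℕ.≤ m → N ℕ.≤ n → ℚ.∣ x m ℚ.- x n ∣ ℚ.< ε)

record ℝ : Set where
  constructor mkℝ
  field
    seq    : ℕ → ℚ
    cauchy : IsCauchy seq

open ℝ public

infix 4 _≈_ _≤_ _<_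

_≈_ : ℝ → ℝ → Set
x ≈ y = ∀ ε → 0ℚ ℚ.< ε →
  ∃[ N ] (∀ n → N ℕ.≤ n → ℚ.∣ seq x n ℚ.- seq y n ∣ ℚ.< ε)

_≤_ : ℝ → ℝ → Set
x ≤ y = ∀ ε → 0ℚ ℚ.< ε →
  ∃[ N ] (∀ n → N ℕ.≤ n → seq x n ℚ.< seq y n ℚ.+ ε)

_<_ : ℝ → ℝ → Set
x < y = ∃[ ε ] (0ℚ ℚ.< ε ×
  ∃[ N ] (∀ n → N ℕ.≤ n → seq x n ℚ.+ ε ℚ.< seq y n))

fromℚ : ℚ → ℝ
fromℚ q = mkℝ (λ _ → q) λ ε 0<ε →
  0 , λ _ _ _ _ → subst (λ d → ℚ.∣ d ∣ ℚ.< ε) (sym (ℚₚ.+-inverseʳ q)) 0<ε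

fromℤ : ℤ → ℝ
fromℤ k = fromℚ (k ℚ./ 1)

0ℝ 1ℝ : ℝ
0ℝ = fromℚ 0ℚ
1ℝ = fromℚ 1ℚ

infixl 6 _+_ _-_
infixl 7 _*_
infix  8 -_

_+_ : ℝ → ℝ → ℝ
x + y = mkℝ (λ n → seq x n ℚ.+ seq y n) sum-cauchy
  where
  open ℚₚ.≤-Reasoning
  sum-cauchy : IsCauchy (λ n → seq x n ℚ.+ seq y n)
  sum-cauchy ε 0<ε
    with cauchy x (ε ℚ.* ½) (half-pos 0<ε) | cauchy y (ε ℚ.* ½) (half-pos 0<ε)
  ... | N , hx | M , hy = N ℕ.⊔ M , λ m n N⊔M≤m N⊔M≤n → begin-strict
    ℚ.∣ (seq x m ℚ.+ seq y m) ℚ.- (seq x n ℚ.+ seq y n) ∣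
      ≡⟨ cong ℚ.∣_∣ (+-sub-distrib (seq x m) (seq y m) (seq x n) (seq y n)) ⟩
    ℚ.∣ (seq x m ℚ.- seq x n) ℚ.+ (seq y m ℚ.- seq y n) ∣
      ≤⟨ ℚₚ.∣p+q∣≤∣p∣+∣q∣ (seq x m ℚ.- seq x n) (seq y m ℚ.- seq y n) ⟩
    ℚ.∣ seq x m ℚ.- seq x n ∣ ℚ.+ ℚ.∣ seq y m ℚ.- seq y n ∣
      <⟨ ℚₚ.+-mono-<
           (hx m n (ℕₚ.m⊔n≤o⇒m≤o N M N⊔M≤m) (ℕₚ.m⊔n≤o⇒m≤o N M N⊔M≤n))
           (hy m n (ℕₚ.m⊔n≤o⇒n≤o N M N⊔M≤m) (ℕₚ.m⊔n≤o⇒n≤o N M N⊔M≤n)) ⟩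
    ε ℚ.* ½ ℚ.+ ε ℚ.* ½
      ≡⟨ halves ε ⟩
    ε ∎

-_ : ℝ → ℝ
- x = mkℝ (λ n → ℚ.- seq x n) neg-cauchy
  where
  neg-cauchy : IsCauchy (λ n → ℚ.- seq x n)
  neg-cauchy ε 0<ε with cauchy x ε 0<ε
  ... | N , hx = N , λ m n N≤m N≤n →
    subst (ℚ._< ε)
      (sym (trans (cong ℚ.∣_∣ (neg-sub-neg (seq x m) (seq x n)))
                  (ℚₚ.∣-p∣≡∣p∣ (seq x m ℚ.- seq x n))))
      (hx m n N≤m N≤n)

_-_ : ℝ → ℝ → ℝ
x - y = x + (- y)

∣_∣ : ℝ → ℝ
∣ x ∣ = mkℝ (λ n → ℚ.∣ seq x n ∣) abs-cauchy
  where
  abs-cauchy : IsCauchy (λ n → ℚ.∣ seq x n ∣)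
  abs-cauchy ε 0<ε with cauchy x ε 0<ε
  ... | N , hx = N , λ m n N≤m N≤n →
    ℚₚ.≤-<-trans (∣∣p∣-∣q∣∣≤∣p-q∣ (seq x m) (seq x n)) (hx m n N≤m N≤n)

EventuallyBounded : (ℕ → ℚ) → Set
EventuallyBounded x =
  ∃[ b ] (0ℚ ℚ.< b × ∃[ N ] (∀ n → N ℕ.≤ n → ℚ.∣ x n ∣ ℚ.≤ b))

eventuallyBounded : ∀ {x} → IsCauchy x → EventuallyBounded x
eventuallyBounded {x} cx = bound (cx 1ℚ (ℚₚ.positive⁻¹ 1ℚ))
  where
  bound : ∃[ N ] (∀ m n → N ℕ.≤ m → N ℕ.≤ n → ℚ.∣ x m ℚ.- x n ∣ ℚ.< 1ℚ) →
          EventuallyBounded x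
  bound (N , hx) = 1ℚ ℚ.+ ℚ.∣ x N ∣
    , ℚₚ.+-mono-<-≤ (ℚₚ.positive⁻¹ 1ℚ) (ℚₚ.0≤∣p∣ (x N))
    , N , λ n N≤n → ℚₚ.≤-trans (∣p∣≤∣p-q∣+∣q∣ (x n) (x N))
        (ℚₚ.+-monoˡ-≤ ℚ.∣ x N ∣ (ℚₚ.<⇒≤ (hx n N N≤n ℕₚ.≤-refl)))

*-cauchy : ∀ {x y} → IsCauchy x → IsCauchy y → IsCauchy (λ n → x n ℚ.* y n)
*-cauchy {x} {y} cx cy ε 0<ε = go (eventuallyBounded {x} cx) (eventuallyBounded {y} cy)
  where
  Goal : Set
  Goal = ∃[ N ] (∀ m n → N ℕ.≤ m → N ℕ.≤ n →
           ℚ.∣ x m ℚ.* y m ℚ.- x n ℚ.* y n ∣ ℚ.< ε)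

  go : EventuallyBounded x → EventuallyBounded y → Goal
  go (a , 0<a , K , x≤a) (b , 0<b , L , y≤b) =
    scaled (divide (a ℚ.+ b) ε (ℚₚ.+-mono-< 0<a 0<b) 0<ε)
    where
    scaled : ∃[ δ ] (0ℚ ℚ.< δ × (a ℚ.+ b) ℚ.* δ ≡ ε) → Goal
    scaled (δ , 0<δ , [a+b]*δ≡ε) = combine (cx δ 0<δ) (cy δ 0<δ)
      where
      combine : ∃[ N ] (∀ m n → N ℕ.≤ m → N ℕ.≤ n → ℚ.∣ x m ℚ.- x n ∣ ℚ.< δ) →
                ∃[ M ] (∀ m n → M ℕ.≤ m → M ℕ.≤ n → ℚ.∣ y m ℚ.- y n ∣ ℚ.< δ) →
                Goal
      combine (N , hx) (M , hy) = (K ℕ.⊔ L) ℕ.⊔ (N ℕ.⊔ M) , λ m n ≤m ≤n →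
        let KL≤m = ℕₚ.m⊔n≤o⇒m≤o (K ℕ.⊔ L) (N ℕ.⊔ M) ≤m
            KL≤n = ℕₚ.m⊔n≤o⇒m≤o (K ℕ.⊔ L) (N ℕ.⊔ M) ≤n
            NM≤m = ℕₚ.m⊔n≤o⇒n≤o (K ℕ.⊔ L) (N ℕ.⊔ M) ≤m
            NM≤n = ℕₚ.m⊔n≤o⇒n≤o (K ℕ.⊔ L) (N ℕ.⊔ M) ≤n
        in subst (ℚ.∣ x m ℚ.* y m ℚ.- x n ℚ.* y n ∣ ℚ.<_)
             (trans (sym (ℚₚ.*-distribʳ-+ δ a b)) [a+b]*δ≡ε)
             (∣x*y-u*v∣<a*δ+b*δ (x m) (y m) (x n) (y n) 0<a 0<b
               (x≤a m (ℕₚ.m⊔n≤o⇒m≤o K L KL≤m))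
               (y≤b n (ℕₚ.m⊔n≤o⇒n≤o K L KL≤n))
               (hy m n (ℕₚ.m⊔n≤o⇒n≤o N M NM≤m) (ℕₚ.m⊔n≤o⇒n≤o N M NM≤n))
               (hx m n (ℕₚ.m⊔n≤o⇒m≤o N M NM≤m) (ℕₚ.m⊔n≤o⇒m≤o N M NM≤n)))

_*_ : ℝ → ℝ → ℝ
x * y = mkℝ (λ n → seq x n ℚ.* seq y n) (*-cauchy {seq x} {seq y} (cauchy x) (cauchy y))

1/3ℝ 2/3ℝ : ℝ
1/3ℝ = fromℚ (ℤ.+ 1 ℚ./ 3)
2/3ℝ = fromℚ (ℤ.+ 2 ℚ./ 3)

------------------------------------------------------------------------
-- Badly approximable numbers

-- A nearest integer is attained, so the distance from y to it exceeds t
-- exactly when the distance from y to every integer does.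
DistanceToℤExceeds : ℝ → ℝ → Set
DistanceToℤExceeds t y = ∀ (p : ℤ) → t < ∣ y - fromℤ p ∣

BA : Pred ℝ 0ℓ
BA A = ∃[ c ] (0ℝ < c ×
  ((x : ℤ) .{{_ : ℤ.NonZero x}} →
    DistanceToℤExceeds (c * fromℚ (ℤ.+ 1 ℚ./ ℤ.∣ x ∣)) (A * fromℤ x)))

------------------------------------------------------------------------
-- The middle-third Cantor set

-- Removing the open middle thirds from stage n leaves one copy of stage n
-- scaled by 1/3 in [0 , 1/3] and one in [2/3 , 1].
CantorStage : ℕ → Pred ℝ 0ℓ
CantorStage zero    x = 0ℝ ≤ x × x ≤ 1ℝ
CantorStage (suc n) x = ∃[ y ] (y ∈ CantorStage n ×
  (x ≈ 1/3ℝ * y ⊎ x ≈ 2/3ℝ + 1/3ℝ * y))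

C : Pred ℝ 0ℓ
C x = ∀ n → x ∈ CantorStage n

------------------------------------------------------------------------
-- Schmidt's game on K ⊆ ℝ

record Ball (K : Pred ℝ 0ℓ) : Set where
  field
    centre   : ℝ
    radius   : ℝ
    centre∈K : centre ∈ K
    radius>0 : 0ℝ < radius

open Ball public

⟦_⟧ : ∀ {K} → Ball K → Pred ℝ 0ℓ
⟦ B ⟧ z = ∣ z - centre B ∣ ≤ radius B

-- r is at most the supremum of the distances between points of K.
AtMostDiameter : Pred ℝ 0ℓ → ℝ → Set
AtMostDiameter K r =
  ∀ b → (∀ x y → x ∈ K → y ∈ K → ∣ x - y ∣ ≤ b) → r ≤ b

-- V may be chosen after U by a player whose radii shrink by the factor γ.
LegalMove : ∀ {K} → ℝ → Ball K → Ball K → Set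
LegalMove γ U V = ⟦ V ⟧ ⊆ ⟦ U ⟧ × radius V ≈ γ * radius U

-- White's k-th ball as a function of Black's balls U(0), …, U(k).  It need
-- not respect _≈_; choosing representatives of the balls makes any winning
-- strategy respect it, so classically nothing changes.
Strategy : Pred ℝ 0ℓ → Set
Strategy K = ∀ k → Vec (Ball K) (suc k) → Ball K

reply : ∀ {K} → Strategy K → (ℕ → Ball K) → ℕ → Ball K
reply σ U k = σ k (tabulate (U ∘ toℕ))

-- Black's balls U(0), …, U(n) obey the rules against σ.
BlackLegal : ∀ {K} → ℝ → Strategy K → (ℕ → Ball K) → ℕ → Set
BlackLegal {K} β σ U zero    = AtMostDiameter K (radius (U 0))
BlackLegal     β σ U (suc n) =
  BlackLegal β σ U n × LegalMove β (reply σ U n) (U (suc n))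

record WinningStrategy (K S : Pred ℝ 0ℓ) (α β : ℝ) : Set where
  field
    σ     : Strategy K
    legal : ∀ U n → BlackLegal β σ U n → LegalMove α (U n) (reply σ U n)
    wins  : ∀ U → (∀ n → BlackLegal β σ U n) →
            ∃[ x ] ((∀ k → x ∈ ⟦ U k ⟧) × x ∈ S)

InOpenUnitInterval : Pred ℝ 0ℓ
InOpenUnitInterval γ = 0ℝ < γ × γ < 1ℝ

Winning : (K S : Pred ℝ 0ℓ) → ℝ → Set
Winning K S α = ∀ β → InOpenUnitInterval β → WinningStrategy K S α β

------------------------------------------------------------------------
-- Winning dimension

WinningParameter : (K S : Pred ℝ 0ℓ) → Pred ℝ 0ℓ
WinningParameter K S α = InOpenUnitInterval α × Winning K S α

UpperBound : Pred ℝ 0ℓ → Pred ℝ 0ℓ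
UpperBound P b = ∀ x → x ∈ P → x ≤ b

LeastUpperBound : Pred ℝ 0ℓ → Pred ℝ 0ℓ
LeastUpperBound P d = UpperBound P d × (∀ b → UpperBound P b → d ≤ b)

-- The winning dimension of S is d.  This is a relation because least upper
-- bounds of bounded inhabited sets need not exist constructively.
Windim : (K S : Pred ℝ 0ℓ) → Pred ℝ 0ℓ
Windim K S d =
  ((∀ α → ¬ WinningParameter K S α) → d ≈ 0ℝ) ×
  (¬ (∀ α → ¬ WinningParameter K S α) → LeastUpperBound (WinningParameter K S) d)

{-# OPTIONS --safe #-}

-- If 1/3 < α, Black wins with β = q / α, where q = 3⁻ᵐ ≤ α − 1/3, by playing
-- the ball of centre 0 and radius qᵏ at every stage k, whatever White does.
-- White's centre c lies in C and, as White's ball fits inside Black's,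
-- c ≤ (1 − α) qᵏ < (2/3) qᵏ.  Since qᵏ is a power of 1/3, the gap of C between
-- (1/3) qᵏ and (2/3) qᵏ forces c ≤ (1/3) qᵏ, so White's ball contains the ball
-- of centre 0 and radius q qᵏ.  The outcome 0 is not badly approximable.
module Submission where

open import Data.Empty using (⊥)
open import Data.Integer.Base as ℤ using ()
import Data.Integer.Properties as ℤₚ
open import Data.Nat.Base as ℕ using (ℕ; zero; suc)
import Data.Nat.Coprimality as Coprimality
import Data.Nat.Properties as ℕₚ
open import Data.Product.Base using (∃-syntax; _×_; _,_; proj₁; proj₂)
open import Data.Rational.Base as ℚ using (ℚ; 0ℚ; 1ℚ; ½; mkℚ)
import Data.Rational.Properties as ℚₚ
import Data.Rational.Unnormalised.Base as ℚᵘ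
import Data.Rational.Unnormalised.Properties as ℚᵘₚ
open import Data.Sum.Base using (inj₁; inj₂)
open import Data.Unit.Base using (tt)
open import Level using (0ℓ)
open import Relation.Binary.PropositionalEquality
  using (_≡_; refl; sym; trans; cong; cong₂; subst; subst₂; module ≡-Reasoning)
open import Relation.Nullary.Decidable.Core using (dec⇒maybe; toWitness)
open import Relation.Nullary.Negation using (¬_; contradiction)
open import Relation.Unary using (_∈_; _⊆_; _∩_)
open import Tactic.RingSolver using (solve-∀)
open import Tactic.RingSolver.Core.AlmostCommutativeRing
  using (AlmostCommutativeRing; fromCommutativeRing)
open import Defs

-- Rational numbers

ℚ-ring : AlmostCommutativeRing 0ℓ 0ℓ
ℚ-ring = fromCommutativeRing ℚₚ.+-*-commutativeRing (λ q → dec⇒maybe (0ℚ ℚₚ.≟ q))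

[p-q]+q≡p : ∀ p q → (p ℚ.- q) ℚ.+ q ≡ p
[p-q]+q≡p = solve-∀ ℚ-ring

p≡q+[p-q] : ∀ p q → p ≡ q ℚ.+ (p ℚ.- q)
p≡q+[p-q] = solve-∀ ℚ-ring

-[p-q]≡q-p : ∀ p q → ℚ.- (p ℚ.- q) ≡ q ℚ.- p
-[p-q]≡q-p = solve-∀ ℚ-ring

[p-q]+[q-r]≡p-r : ∀ p q r → (p ℚ.- q) ℚ.+ (q ℚ.- r) ≡ p ℚ.- r
[p-q]+[q-r]≡p-r = solve-∀ ℚ-ring

*-distribˡ-sub : ∀ p q r → p ℚ.* q ℚ.- p ℚ.* r ≡ p ℚ.* (q ℚ.- r)
*-distribˡ-sub = solve-∀ ℚ-ring

+-interchange : ∀ p q r s → (p ℚ.+ q) ℚ.+ (r ℚ.+ s) ≡ (p ℚ.+ r) ℚ.+ (q ℚ.+ s)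
+-interchange = solve-∀ ℚ-ring

ε½+ε½≡ε : ∀ ε → ε ℚ.* ½ ℚ.+ ε ℚ.* ½ ≡ ε
ε½+ε½≡ε ε = trans (sym (ℚₚ.*-distribˡ-+ ε ½ ½)) (ℚₚ.*-identityʳ ε)

+-split-half : ∀ p ε → (p ℚ.+ ε ℚ.* ½) ℚ.+ ε ℚ.* ½ ≡ p ℚ.+ ε
+-split-half p ε = trans (ℚₚ.+-assoc p (ε ℚ.* ½) (ε ℚ.* ½))
  (cong (p ℚ.+_) (ε½+ε½≡ε ε))

*-pos : ∀ {p q} → 0ℚ ℚ.< p → 0ℚ ℚ.< q → 0ℚ ℚ.< p ℚ.* q
*-pos {p} {q} 0<p 0<q =
  subst (ℚ._< p ℚ.* q) (ℚₚ.*-zeroʳ p)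
    (ℚₚ.*-monoʳ-<-pos p {{ℚ.positive 0<p}} 0<q)

half-pos : ∀ {ε} → 0ℚ ℚ.< ε → 0ℚ ℚ.< ε ℚ.* ½
half-pos 0<ε = *-pos 0<ε (ℚₚ.positive⁻¹ ½)

p<p+ε : ∀ p {ε} → 0ℚ ℚ.< ε → p ℚ.< p ℚ.+ ε
p<p+ε p {ε} 0<ε = subst (ℚ._< p ℚ.+ ε) (ℚₚ.+-identityʳ p) (ℚₚ.+-monoʳ-< p 0<ε)

+-cancelʳ-< : ∀ {p q} r → p ℚ.+ r ℚ.< q ℚ.+ r → p ℚ.< q
+-cancelʳ-< r h = ℚₚ.≰⇒> λ q≤p →
  ℚₚ.<-irrefl refl (ℚₚ.<-≤-trans h (ℚₚ.+-monoˡ-≤ r q≤p))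

p≤∣p∣ : ∀ p → p ℚ.≤ ℚ.∣ p ∣
p≤∣p∣ p with ℚₚ.≤-total 0ℚ p
... | inj₁ 0≤p = ℚₚ.≤-reflexive (sym (ℚₚ.0≤p⇒∣p∣≡p 0≤p))
... | inj₂ p≤0 = ℚₚ.≤-trans p≤0 (ℚₚ.0≤∣p∣ p)

∣p-q∣≡∣q-p∣ : ∀ p q → ℚ.∣ p ℚ.- q ∣ ≡ ℚ.∣ q ℚ.- p ∣
∣p-q∣≡∣q-p∣ p q =
  trans (sym (ℚₚ.∣-p∣≡∣p∣ (p ℚ.- q))) (cong ℚ.∣_∣ (-[p-q]≡q-p p q))

∣p-q∣<ε⇒p<q+ε : ∀ p q {ε} → ℚ.∣ p ℚ.- q ∣ ℚ.< ε → p ℚ.< q ℚ.+ ε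
∣p-q∣<ε⇒p<q+ε p q {ε} h = subst (ℚ._< q ℚ.+ ε) (sym (p≡q+[p-q] p q))
  (ℚₚ.+-monoʳ-< q (ℚₚ.≤-<-trans (p≤∣p∣ (p ℚ.- q)) h))

divide : ∀ {ε} b → 0ℚ ℚ.< b → 0ℚ ℚ.< ε → ∃[ δ ] (0ℚ ℚ.< δ × b ℚ.* δ ≡ ε)
divide {ε} b 0<b 0<ε = b⁻¹ ℚ.* ε
  , *-pos (ℚₚ.positive⁻¹ b⁻¹ {{ℚₚ.1/pos⇒pos b}}) 0<ε
  , trans (sym (ℚₚ.*-assoc b b⁻¹ ε))
      (trans (cong (ℚ._* ε) (ℚₚ.*-inverseʳ b)) (ℚₚ.*-identityˡ ε))
  where
  instance
    b-positive : ℚ.Positive b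
    b-positive = ℚ.positive 0<b
    b-nonZero : ℚ.NonZero b
    b-nonZero = ℚₚ.pos⇒nonZero b
  b⁻¹ : ℚ
  b⁻¹ = ℚ.1/ b

-- Powers of 1/3 and the Archimedean property

⅓ ⅔ : ℚ
⅓ = ℤ.+ 1 ℚ./ 3
⅔ = ℤ.+ 2 ℚ./ 3

0<⅓ : 0ℚ ℚ.< ⅓
0<⅓ = ℚₚ.positive⁻¹ ⅓

infix 30 ⅓^_

⅓^_ : ℕ → ℚ
⅓^ zero  = 1ℚ
⅓^ suc n = ⅓ ℚ.* ⅓^ n

⅓^-pos : ∀ n → 0ℚ ℚ.< ⅓^ n
⅓^-pos zero    = ℚₚ.positive⁻¹ 1ℚ
⅓^-pos (suc n) = *-pos 0<⅓ (⅓^-pos n)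

⅓*-mono : ∀ {p q} → p ℚ.≤ q → ⅓ ℚ.* p ℚ.≤ ⅓ ℚ.* q
⅓*-mono = ℚₚ.*-monoˡ-≤-nonNeg ⅓

⅓*-≤ : ∀ {p} → 0ℚ ℚ.≤ p → ⅓ ℚ.* p ℚ.≤ p
⅓*-≤ {p} 0≤p = subst (⅓ ℚ.* p ℚ.≤_) (ℚₚ.*-identityˡ p)
  (ℚₚ.*-monoʳ-≤-nonNeg p {{ℚ.nonNegative 0≤p}} (toWitness {a? = ⅓ ℚₚ.≤? 1ℚ} tt))

⅓^-≤1 : ∀ n → ⅓^ n ℚ.≤ 1ℚ
⅓^-≤1 zero    = ℚₚ.≤-refl
⅓^-≤1 (suc n) = ℚₚ.≤-trans (⅓*-≤ (ℚₚ.<⇒≤ (⅓^-pos n))) (⅓^-≤1 n)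

⅓^-+ : ∀ m n → ⅓^ (m ℕ.+ n) ≡ ⅓^ m ℚ.* ⅓^ n
⅓^-+ zero    n = sym (ℚₚ.*-identityˡ (⅓^ n))
⅓^-+ (suc m) n = trans (cong (⅓ ℚ.*_) (⅓^-+ m n)) (sym (ℚₚ.*-assoc ⅓ (⅓^ m) (⅓^ n)))

⅓^-anti : ∀ m n → ⅓^ (m ℕ.+ n) ℚ.≤ ⅓^ n
⅓^-anti zero    n = ℚₚ.≤-refl
⅓^-anti (suc m) n = ℚₚ.≤-trans (⅓*-≤ (ℚₚ.<⇒≤ (⅓^-pos (m ℕ.+ n)))) (⅓^-anti m n)

-- Given in lowest terms rather than as a division by 1, so that numerator and denominator compute
-- without a gcd.
fromℕ : ℕ → ℚ
fromℕ n = mkℚ (ℤ.+ n) 0 (Coprimality.sym (Coprimality.1-coprimeTo n))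

fromℕ-* : ∀ m n → fromℕ (m ℕ.* n) ≡ fromℕ m ℚ.* fromℕ n
fromℕ-* m n = ℚₚ.toℚᵘ-injective (ℚᵘₚ.≃-trans
  (ℚᵘ.*≡* (cong (ℤ._* ℤ.+ 1) (ℤₚ.pos-* m n)))
  (ℚᵘₚ.≃-sym (ℚₚ.toℚᵘ-homo-* (fromℕ m) (fromℕ n))))

n≤3^n : ∀ n → n ℕ.≤ 3 ℕ.^ n
n≤3^n zero    = ℕ.z≤n
n≤3^n (suc n) = ℕₚ.+-mono-≤ (ℕₚ.m^n>0 3 n) (ℕₚ.≤-trans (n≤3^n n) (ℕₚ.m≤m+n (3 ℕ.^ n) _))

-- A nonnegative p is at most its numerator a, and a ≤ 3ᵃ, so the numerator itself serves as
-- exponent.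
p≤3^n : ∀ p → ∃[ n ] p ℚ.≤ fromℕ (3 ℕ.^ n)
p≤3^n (mkℚ (ℤ.+ a) d _) = a , ℚ.*≤* (begin
  ℤ.+ a ℤ.* ℤ.+ 1          ≡⟨ ℤₚ.*-identityʳ (ℤ.+ a) ⟩
  ℤ.+ a                    ≤⟨ ℤ.+≤+ (ℕₚ.≤-trans (n≤3^n a) (ℕₚ.m≤m*n (3 ℕ.^ a) (suc d))) ⟩
  ℤ.+ (3 ℕ.^ a ℕ.* suc d)  ≡⟨ ℤₚ.pos-* (3 ℕ.^ a) (suc d) ⟩
  ℤ.+ (3 ℕ.^ a) ℤ.* ℤ.+ suc d ∎)
  where open ℤₚ.≤-Reasoning
p≤3^n p@(mkℚ ℤ.-[1+ _ ] _ _) = 0 , ℚₚ.<⇒≤ (ℚₚ.neg<pos p 1ℚ)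

⅓^n*3^n≡1 : ∀ n → ⅓^ n ℚ.* fromℕ (3 ℕ.^ n) ≡ 1ℚ
⅓^n*3^n≡1 zero    = refl
⅓^n*3^n≡1 (suc n) = begin
  (⅓ ℚ.* ⅓^ n) ℚ.* fromℕ (3 ℕ.* 3 ℕ.^ n)
    ≡⟨ cong ((⅓ ℚ.* ⅓^ n) ℚ.*_) (fromℕ-* 3 (3 ℕ.^ n)) ⟩
  (⅓ ℚ.* ⅓^ n) ℚ.* (fromℕ 3 ℚ.* fromℕ (3 ℕ.^ n))
    ≡⟨ *-interchange ⅓ (⅓^ n) (fromℕ 3) (fromℕ (3 ℕ.^ n)) ⟩
  (⅓ ℚ.* fromℕ 3) ℚ.* (⅓^ n ℚ.* fromℕ (3 ℕ.^ n))
    -- `⅓ ℚ.* fromℕ 3` computes to `1ℚ`.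
    ≡⟨ cong (1ℚ ℚ.*_) (⅓^n*3^n≡1 n) ⟩
  1ℚ ∎
  where
  open ≡-Reasoning
  *-interchange : ∀ p q r s → (p ℚ.* q) ℚ.* (r ℚ.* s) ≡ (p ℚ.* r) ℚ.* (q ℚ.* s)
  *-interchange = solve-∀ ℚ-ring

-- With r = 1/ε and r ≤ 3ⁿ, the claim multiplied by 3ⁿ becomes 1 = εr ≤ ε3ⁿ.
⅓^-archimedean : ∀ ε → 0ℚ ℚ.< ε → ∃[ n ] ⅓^ n ℚ.≤ ε
⅓^-archimedean ε 0<ε with divide ε 0<ε (ℚₚ.positive⁻¹ 1ℚ)
... | r , _ , εr≡1 with p≤3^n r
... | n , r≤3^n = n , ℚₚ.*-cancelʳ-≤-pos (fromℕ (3 ℕ.^ n)) {{3^n-pos}} (begin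
  ⅓^ n ℚ.* fromℕ (3 ℕ.^ n)  ≡⟨ trans (⅓^n*3^n≡1 n) (sym εr≡1) ⟩
  ε ℚ.* r                   ≤⟨ ℚₚ.*-monoˡ-≤-nonNeg ε {{ℚ.nonNegative (ℚₚ.<⇒≤ 0<ε)}} r≤3^n ⟩
  ε ℚ.* fromℕ (3 ℕ.^ n)     ∎)
  where
  open ℚₚ.≤-Reasoning
  3^n-pos : ℚ.Positive (fromℕ (3 ℕ.^ n))
  3^n-pos = ℤ.positive (ℤ.+<+ (ℕₚ.m^n>0 3 n))

-- Real numbers

-- The tail quantifier inside `_≈_`, `_≤_` and `_<_`; with `map` and `zipWith`, facts about reals
-- reduce to facts about single rational terms.
Eventually : (ℕ → Set) → Set
Eventually P = ∃[ N ] (∀ n → N ℕ.≤ n → P n)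

always : ∀ {P : ℕ → Set} → (∀ n → P n) → Eventually P
always p = 0 , λ n _ → p n

map : ∀ {P Q : ℕ → Set} → (∀ n → P n → Q n) → Eventually P → Eventually Q
map f (N , p) = N , λ n N≤n → f n (p n N≤n)

zipWith : ∀ {P Q R : ℕ → Set} → (∀ n → P n → Q n → R n) →
          Eventually P → Eventually Q → Eventually R
zipWith f (N , p) (M , q) = N ℕ.⊔ M , λ n N⊔M≤n →
  f n (p n (ℕₚ.m⊔n≤o⇒m≤o N M N⊔M≤n)) (q n (ℕₚ.m⊔n≤o⇒n≤o N M N⊔M≤n))

eventually⇒∃ : ∀ {P : ℕ → Set} → Eventually P → ∃[ n ] P n
eventually⇒∃ (N , p) = N , p N ℕₚ.≤-refl

seq-≤⇒≤ : ∀ x y → Eventually (λ n → seq x n ℚ.≤ seq y n) → x ≤ y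
seq-≤⇒≤ x y h ε 0<ε = map (λ n p → ℚₚ.≤-<-trans p (p<p+ε (seq y n) 0<ε)) h

seq-≡⇒≈ : ∀ x y → Eventually (λ n → seq x n ≡ seq y n) → x ≈ y
seq-≡⇒≈ x y h ε 0<ε = map (λ n p → subst (λ t → ℚ.∣ t ∣ ℚ.< ε)
  (sym (trans (cong (ℚ._- seq y n) p) (ℚₚ.+-inverseʳ (seq y n)))) 0<ε) h

≤-trans : ∀ x y z → x ≤ y → y ≤ z → x ≤ z
≤-trans x y z x≤y y≤z ε 0<ε = zipWith
  (λ n p q → ℚₚ.<-trans p (subst (seq y n ℚ.+ ε ℚ.* ½ ℚ.<_)
    (+-split-half (seq z n) ε) (ℚₚ.+-monoˡ-< (ε ℚ.* ½) q)))
  (x≤y (ε ℚ.* ½) (half-pos 0<ε)) (y≤z (ε ℚ.* ½) (half-pos 0<ε))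

≈-sym : ∀ x y → x ≈ y → y ≈ x
≈-sym x y x≈y ε 0<ε =
  map (λ n → subst (ℚ._< ε) (∣p-q∣≡∣q-p∣ (seq x n) (seq y n))) (x≈y ε 0<ε)

≈-trans : ∀ x y z → x ≈ y → y ≈ z → x ≈ z
≈-trans x y z x≈y y≈z ε 0<ε = zipWith
  (λ n p q → subst₂ ℚ._<_
    (cong ℚ.∣_∣ ([p-q]+[q-r]≡p-r (seq x n) (seq y n) (seq z n))) (ε½+ε½≡ε ε)
    (ℚₚ.≤-<-trans (ℚₚ.∣p+q∣≤∣p∣+∣q∣ (seq x n ℚ.- seq y n) (seq y n ℚ.- seq z n))
      (ℚₚ.+-mono-< p q)))
  (x≈y (ε ℚ.* ½) (half-pos 0<ε)) (y≈z (ε ℚ.* ½) (half-pos 0<ε))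

≈⇒≤ : ∀ x y → x ≈ y → x ≤ y
≈⇒≤ x y x≈y ε 0<ε = map (λ n → ∣p-q∣<ε⇒p<q+ε (seq x n) (seq y n)) (x≈y ε 0<ε)

≈⇒≥ : ∀ x y → x ≈ y → y ≤ x
≈⇒≥ x y x≈y = ≈⇒≤ y x (≈-sym x y x≈y)

fromℚ-mono : ∀ {p q} → p ℚ.≤ q → fromℚ p ≤ fromℚ q
fromℚ-mono {p} {q} p≤q = seq-≤⇒≤ (fromℚ p) (fromℚ q) (always λ _ → p≤q)

<⇒≱ : ∀ x y → x < y → ¬ y ≤ x
<⇒≱ x y (ε , 0<ε , x+ε<y) y≤x
  with eventually⇒∃ (zipWith (λ n p q → ℚₚ.<-trans p q) x+ε<y (y≤x ε 0<ε))
... | _ , p = ℚₚ.<-irrefl refl p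

fromℚ-cancel : ∀ {p q} → fromℚ p ≤ fromℚ q → p ℚ.≤ q
fromℚ-cancel {p} {q} h = ℚₚ.≮⇒≥ λ q<p →
  let ε     = p ℚ.- q
      q+ε≡p = trans (ℚₚ.+-comm q ε) ([p-q]+q≡p p q)
      0<ε   = subst (ℚ._< ε) (ℚₚ.+-inverseʳ q) (ℚₚ.+-monoˡ-< (ℚ.- q) q<p)
  in ℚₚ.<-irrefl (sym q+ε≡p) (proj₂ (eventually⇒∃ (h ε 0<ε)))

-- One term beyond the Cauchy modulus for ε/4 is compared with q + ε/2, which is decidable. If it is
-- below, the tail stays under q + ε; if above, the tail stays over q + ε/4, which would make x
-- exceed q.
≯fromℚ⇒≤fromℚ : ∀ x q → ¬ fromℚ q < x → x ≤ fromℚ q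
≯fromℚ⇒≤fromℚ x q q≮x ε 0<ε = go (cauchy x δ 0<δ)
  where
  δ = ε ℚ.* ½ ℚ.* ½
  0<δ = half-pos (half-pos 0<ε)

  go : ∃[ N ] (∀ m n → N ℕ.≤ m → N ℕ.≤ n → ℚ.∣ seq x m ℚ.- seq x n ∣ ℚ.< δ) →
       Eventually (λ n → seq x n ℚ.< q ℚ.+ ε)
  go (N , hx) with ℚₚ.≤-total (seq x N) (q ℚ.+ ε ℚ.* ½)
  ... | inj₁ xN≤q+ε½ = N , λ n N≤n → begin-strict
    seq x n                        <⟨ ∣p-q∣<ε⇒p<q+ε (seq x n) (seq x N) (hx n N N≤n ℕₚ.≤-refl) ⟩
    seq x N ℚ.+ δ                  <⟨ ℚₚ.+-mono-≤-< xN≤q+ε½ (subst (δ ℚ.<_) (ε½+ε½≡ε (ε ℚ.* ½)) (p<p+ε δ 0<δ)) ⟩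
    (q ℚ.+ ε ℚ.* ½) ℚ.+ ε ℚ.* ½    ≡⟨ +-split-half q ε ⟩
    q ℚ.+ ε ∎
    where open ℚₚ.≤-Reasoning
  ... | inj₂ q+ε½≤xN = contradiction q<x q≮x
    where
    q<x : fromℚ q < x
    q<x = δ , 0<δ , N , λ n N≤n →
      +-cancelʳ-< δ (begin-strict
        (q ℚ.+ δ) ℚ.+ δ      ≡⟨ trans (ℚₚ.+-assoc q δ δ) (cong (q ℚ.+_) (ε½+ε½≡ε (ε ℚ.* ½))) ⟩
        q ℚ.+ ε ℚ.* ½        ≤⟨ q+ε½≤xN ⟩
        seq x N              <⟨ ∣p-q∣<ε⇒p<q+ε (seq x N) (seq x n) (hx N n ℕₚ.≤-refl N≤n) ⟩
        seq x n ℚ.+ δ        ∎)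
      where open ℚₚ.≤-Reasoning

+-mono-≤ : ∀ x y u v → x ≤ y → u ≤ v → x + u ≤ y + v
+-mono-≤ x y u v x≤y u≤v ε 0<ε = zipWith
  (λ n p q → subst (seq x n ℚ.+ seq u n ℚ.<_)
    (trans (+-interchange (seq y n) (ε ℚ.* ½) (seq v n) (ε ℚ.* ½))
           (cong ((seq y n ℚ.+ seq v n) ℚ.+_) (ε½+ε½≡ε ε)))
    (ℚₚ.+-mono-< p q))
  (x≤y (ε ℚ.* ½) (half-pos 0<ε)) (u≤v (ε ℚ.* ½) (half-pos 0<ε))

fromℚ-*-mono : ∀ q x y → 0ℚ ℚ.< q → x ≤ y → fromℚ q * x ≤ fromℚ q * y
fromℚ-*-mono q x y 0<q x≤y ε 0<ε with divide q 0<q 0<ε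
... | δ , 0<δ , qδ≡ε = map
  (λ n p → subst (q ℚ.* seq x n ℚ.<_)
    (trans (ℚₚ.*-distribˡ-+ q (seq y n) δ) (cong (q ℚ.* seq y n ℚ.+_) qδ≡ε))
    (ℚₚ.*-monoʳ-<-pos q {{ℚ.positive 0<q}} p))
  (x≤y δ 0<δ)

-- If b bounds a tail of z, terms of x and y within ε/b have products with z within ε.
*-congˡ : ∀ z x y → x ≈ y → z * x ≈ z * y
*-congˡ z x y x≈y ε 0<ε = go (eventuallyBounded {seq z} (cauchy z))
  where
  open ℚₚ.≤-Reasoning
  close : ∀ {b δ} → 0ℚ ℚ.< b → b ℚ.* δ ≡ ε →
          ∀ n → ℚ.∣ seq z n ∣ ℚ.≤ b → ℚ.∣ seq x n ℚ.- seq y n ∣ ℚ.< δ →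
          ℚ.∣ seq z n ℚ.* seq x n ℚ.- seq z n ℚ.* seq y n ∣ ℚ.< ε
  close {b} {δ} 0<b bδ≡ε n ∣z∣≤b ∣x-y∣<δ = begin-strict
    ℚ.∣ seq z n ℚ.* seq x n ℚ.- seq z n ℚ.* seq y n ∣
      ≡⟨ cong ℚ.∣_∣ (*-distribˡ-sub (seq z n) (seq x n) (seq y n)) ⟩
    ℚ.∣ seq z n ℚ.* (seq x n ℚ.- seq y n) ∣
      ≡⟨ ℚₚ.∣p*q∣≡∣p∣*∣q∣ (seq z n) (seq x n ℚ.- seq y n) ⟩
    ℚ.∣ seq z n ∣ ℚ.* ℚ.∣ seq x n ℚ.- seq y n ∣
      ≤⟨ ℚₚ.*-monoʳ-≤-nonNeg ℚ.∣ seq x n ℚ.- seq y n ∣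
           {{ℚₚ.∣-∣-nonNeg (seq x n ℚ.- seq y n)}} ∣z∣≤b ⟩
    b ℚ.* ℚ.∣ seq x n ℚ.- seq y n ∣
      <⟨ ℚₚ.*-monoʳ-<-pos b {{ℚ.positive 0<b}} ∣x-y∣<δ ⟩
    b ℚ.* δ
      ≡⟨ bδ≡ε ⟩
    ε ∎

  go : EventuallyBounded (seq z) →
       Eventually (λ n → ℚ.∣ seq z n ℚ.* seq x n ℚ.- seq z n ℚ.* seq y n ∣ ℚ.< ε)
  go (b , 0<b , z≤b) =
    let δ , 0<δ , bδ≡ε = divide b 0<b 0<ε
    in zipWith (close 0<b bδ≡ε) z≤b (x≈y δ 0<δ)

-- Terms of a nonnegative real may be negative, but eventually only by less than ε/2; such a term
-- satisfies |t| = -t < ε/2 < t + ε.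
∣x∣≤x : ∀ x → 0ℝ ≤ x → ∣ x ∣ ≤ x
∣x∣≤x x 0≤x ε 0<ε = map bound (0≤x (ε ℚ.* ½) (half-pos 0<ε))
  where
  -p+[p+q]≡q : ∀ p q → ℚ.- p ℚ.+ (p ℚ.+ q) ≡ q
  -p+[p+q]≡q = solve-∀ ℚ-ring

  bound : ∀ n → 0ℚ ℚ.< seq x n ℚ.+ ε ℚ.* ½ → ℚ.∣ seq x n ∣ ℚ.< seq x n ℚ.+ ε
  bound n 0<x+ε½ with ℚₚ.∣p∣≡p∨∣p∣≡-p (seq x n)
  ... | inj₁ eq = subst (ℚ._< seq x n ℚ.+ ε) (sym eq) (p<p+ε (seq x n) 0<ε)
  ... | inj₂ eq = begin-strict
    ℚ.∣ seq x n ∣                               ≡⟨ eq ⟩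
    ℚ.- seq x n                                 <⟨ p<p+ε (ℚ.- seq x n) 0<x+ε½ ⟩
    ℚ.- seq x n ℚ.+ (seq x n ℚ.+ ε ℚ.* ½)       ≡⟨ -p+[p+q]≡q (seq x n) (ε ℚ.* ½) ⟩
    ε ℚ.* ½                                     <⟨ ε½<x+ε ⟩
    seq x n ℚ.+ ε                               ∎
    where
    open ℚₚ.≤-Reasoning
    ε½<x+ε : ε ℚ.* ½ ℚ.< seq x n ℚ.+ ε
    ε½<x+ε = subst₂ ℚ._<_ (ℚₚ.+-identityˡ (ε ℚ.* ½)) (+-split-half (seq x n) ε)
      (ℚₚ.+-monoˡ-< (ε ℚ.* ½) 0<x+ε½)

∣x-y∣≤∣x-0∣+∣y∣ : ∀ x y → ∣ x - y ∣ ≤ ∣ x - 0ℝ ∣ + ∣ y ∣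
∣x-y∣≤∣x-0∣+∣y∣ x y = seq-≤⇒≤ ∣ x - y ∣ (∣ x - 0ℝ ∣ + ∣ y ∣) (always λ n →
  subst (λ t → ℚ.∣ seq x n ℚ.- seq y n ∣ ℚ.≤ ℚ.∣ t ∣ ℚ.+ ℚ.∣ seq y n ∣)
    (sym (ℚₚ.+-identityʳ (seq x n)))
    (ℚₚ.∣p-q∣≤∣p∣+∣q∣ (seq x n) (seq y n)))

-- Reciprocals

-- Truncating at ⅓ makes every term invertible without changing a limit above ⅓.
module Reciprocal (x : ℝ) (⅓≤x : Eventually (λ n → ⅓ ℚ.≤ seq x n)) where

  truncated : ℕ → ℚ
  truncated n = seq x n ℚ.⊔ ⅓

  private instance
    truncated-pos : ∀ {n} → ℚ.Positive (truncated n)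
    truncated-pos {n} = ℚ.positive (ℚₚ.<-≤-trans 0<⅓ (ℚₚ.p≤q⊔p (seq x n) ⅓))
    truncated-nonZero : ∀ {n} → ℚ.NonZero (truncated n)
    truncated-nonZero {n} = ℚₚ.pos⇒nonZero (truncated n)

  inv : ℕ → ℚ
  inv n = ℚ.1/ truncated n

  inv-≥0 : ∀ n → 0ℚ ℚ.≤ inv n
  inv-≥0 n = ℚₚ.<⇒≤ (ℚₚ.positive⁻¹ (inv n) {{ℚₚ.1/pos⇒pos (truncated n)}})

  inv-≤3 : ∀ n → inv n ℚ.≤ fromℕ 3
  inv-≤3 n = begin
    -- The factor 1 is read as `fromℕ 3 ℚ.* ⅓`, which computes to it.
    inv n                                ≡⟨ sym (ℚₚ.*-identityˡ (inv n)) ⟩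
    (fromℕ 3 ℚ.* ⅓) ℚ.* inv n            ≡⟨ ℚₚ.*-assoc (fromℕ 3) ⅓ (inv n) ⟩
    fromℕ 3 ℚ.* (⅓ ℚ.* inv n)
      ≤⟨ ℚₚ.*-monoˡ-≤-nonNeg (fromℕ 3)
           (ℚₚ.*-monoʳ-≤-nonNeg (inv n) {{ℚ.nonNegative (inv-≥0 n)}} (ℚₚ.p≤q⊔p (seq x n) ⅓)) ⟩
    fromℕ 3 ℚ.* (truncated n ℚ.* inv n)  ≡⟨ cong (fromℕ 3 ℚ.*_) (ℚₚ.*-inverseʳ (truncated n)) ⟩
    fromℕ 3                              ∎
    where open ℚₚ.≤-Reasoning

  x*inv≡1 : Eventually (λ n → seq x n ℚ.* inv n ≡ 1ℚ)
  x*inv≡1 = map (λ n ⅓≤xn → trans (cong (ℚ._* inv n) (sym (ℚₚ.p≥q⇒p⊔q≡p ⅓≤xn)))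
                                  (ℚₚ.*-inverseʳ (truncated n))) ⅓≤x

  -- The identity 1/s - 1/t = (1/s)(1/t)(t - s); its hypotheses hold wherever truncation changes
  -- nothing.
  inv-sub : ∀ m n → seq x m ℚ.* inv m ≡ 1ℚ → seq x n ℚ.* inv n ≡ 1ℚ →
            inv m ℚ.- inv n ≡ (inv m ℚ.* inv n) ℚ.* (seq x n ℚ.- seq x m)
  inv-sub m n xm xn = begin
    inv m ℚ.- inv n
      ≡⟨ sym (cong₂ ℚ._-_ (ℚₚ.*-identityˡ (inv m)) (ℚₚ.*-identityˡ (inv n))) ⟩
    1ℚ ℚ.* inv m ℚ.- 1ℚ ℚ.* inv n
      ≡⟨ sym (cong₂ (λ s t → s ℚ.* inv m ℚ.- t ℚ.* inv n) xn xm) ⟩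
    (seq x n ℚ.* inv n) ℚ.* inv m ℚ.- (seq x m ℚ.* inv m) ℚ.* inv n
      ≡⟨ factor (seq x n) (inv n) (seq x m) (inv m) ⟩
    (inv m ℚ.* inv n) ℚ.* (seq x n ℚ.- seq x m) ∎
    where
    open ≡-Reasoning
    factor : ∀ p q r s →
      (p ℚ.* q) ℚ.* s ℚ.- (r ℚ.* s) ℚ.* q ≡ (s ℚ.* q) ℚ.* (p ℚ.- r)
    factor = solve-∀ ℚ-ring

  inv-lipschitz : ∀ m n → seq x m ℚ.* inv m ≡ 1ℚ → seq x n ℚ.* inv n ≡ 1ℚ →
                  ℚ.∣ inv m ℚ.- inv n ∣ ℚ.≤ fromℕ 9 ℚ.* ℚ.∣ seq x n ℚ.- seq x m ∣
  inv-lipschitz m n xm xn = begin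
    ℚ.∣ inv m ℚ.- inv n ∣
      ≡⟨ cong ℚ.∣_∣ (inv-sub m n xm xn) ⟩
    ℚ.∣ (inv m ℚ.* inv n) ℚ.* (seq x n ℚ.- seq x m) ∣
      ≡⟨ ℚₚ.∣p*q∣≡∣p∣*∣q∣ (inv m ℚ.* inv n) (seq x n ℚ.- seq x m) ⟩
    ℚ.∣ inv m ℚ.* inv n ∣ ℚ.* ℚ.∣ seq x n ℚ.- seq x m ∣
      ≤⟨ ℚₚ.*-monoʳ-≤-nonNeg ℚ.∣ seq x n ℚ.- seq x m ∣
           {{ℚₚ.∣-∣-nonNeg (seq x n ℚ.- seq x m)}} ∣inv*inv∣≤9 ⟩
    fromℕ 9 ℚ.* ℚ.∣ seq x n ℚ.- seq x m ∣ ∎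
    where
    open ℚₚ.≤-Reasoning
    ∣inv*inv∣≤9 : ℚ.∣ inv m ℚ.* inv n ∣ ℚ.≤ fromℕ 9
    ∣inv*inv∣≤9 = begin
      ℚ.∣ inv m ℚ.* inv n ∣          ≡⟨ ℚₚ.∣p*q∣≡∣p∣*∣q∣ (inv m) (inv n) ⟩
      ℚ.∣ inv m ∣ ℚ.* ℚ.∣ inv n ∣
        ≡⟨ cong₂ ℚ._*_ (ℚₚ.0≤p⇒∣p∣≡p (inv-≥0 m)) (ℚₚ.0≤p⇒∣p∣≡p (inv-≥0 n)) ⟩
      inv m ℚ.* inv n
        ≤⟨ ℚₚ.*-monoʳ-≤-nonNeg (inv n) {{ℚ.nonNegative (inv-≥0 n)}} (inv-≤3 m) ⟩
      fromℕ 3 ℚ.* inv n              ≤⟨ ℚₚ.*-monoˡ-≤-nonNeg (fromℕ 3) (inv-≤3 n) ⟩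
      fromℕ 9                        ∎

  inv-cauchy : IsCauchy inv
  inv-cauchy ε 0<ε = go (divide (fromℕ 9) (ℚₚ.positive⁻¹ (fromℕ 9)) 0<ε) x*inv≡1
    where
    go : ∃[ δ ] (0ℚ ℚ.< δ × fromℕ 9 ℚ.* δ ≡ ε) →
         Eventually (λ n → seq x n ℚ.* inv n ≡ 1ℚ) →
         ∃[ N ] (∀ m n → N ℕ.≤ m → N ℕ.≤ n → ℚ.∣ inv m ℚ.- inv n ∣ ℚ.< ε)
    go (δ , 0<δ , 9δ≡ε) (N , x*inv) with cauchy x δ 0<δ
    ... | M , hx = N ℕ.⊔ M , λ m n ≤m ≤n → subst (ℚ.∣ inv m ℚ.- inv n ∣ ℚ.<_) 9δ≡ε
      (ℚₚ.≤-<-trans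
        (inv-lipschitz m n (x*inv m (ℕₚ.m⊔n≤o⇒m≤o N M ≤m)) (x*inv n (ℕₚ.m⊔n≤o⇒m≤o N M ≤n)))
        (ℚₚ.*-monoʳ-<-pos (fromℕ 9)
          -- The indices are exchanged because `inv-sub` reverses the difference.
          (hx n m (ℕₚ.m⊔n≤o⇒n≤o N M ≤n) (ℕₚ.m⊔n≤o⇒n≤o N M ≤m))))

-- The Cantor set

-- Both similarities y ↦ y/3 and y ↦ 2/3 + y/3 preserve nonnegativity, so induction on the stage
-- applies.
stage-nonneg : ∀ n x → x ∈ CantorStage n → 0ℝ ≤ x
⅓*-nonneg : ∀ n y → y ∈ CantorStage n → 0ℝ ≤ 1/3ℝ * y

stage-nonneg zero    x (0≤x , _) = 0≤x
stage-nonneg (suc n) x (y , y∈ , inj₁ x≈) =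
  ≤-trans 0ℝ (1/3ℝ * y) x (⅓*-nonneg n y y∈) (≈⇒≥ x (1/3ℝ * y) x≈)
stage-nonneg (suc n) x (y , y∈ , inj₂ x≈) =
  ≤-trans 0ℝ (2/3ℝ + 1/3ℝ * y) x
    (+-mono-≤ 0ℝ 2/3ℝ 0ℝ (1/3ℝ * y) (fromℚ-mono (ℚₚ.nonNegative⁻¹ ⅔)) (⅓*-nonneg n y y∈))
    (≈⇒≥ x (2/3ℝ + 1/3ℝ * y) x≈)

⅓*-nonneg n y y∈ = fromℚ-*-mono ⅓ 0ℝ y 0<⅓ (stage-nonneg n y y∈)

right-part-≥⅔ : ∀ n x y → y ∈ CantorStage n → x ≈ 2/3ℝ + 1/3ℝ * y → 2/3ℝ ≤ x
right-part-≥⅔ n x y y∈ x≈ = ≤-trans 2/3ℝ (2/3ℝ + 1/3ℝ * y) x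
  (+-mono-≤ 2/3ℝ 2/3ℝ 0ℝ (1/3ℝ * y) (fromℚ-mono (ℚₚ.≤-refl {⅔})) (⅓*-nonneg n y y∈))
  (≈⇒≥ x (2/3ℝ + 1/3ℝ * y) x≈)

⅔*-comm : ∀ p → ⅓ ℚ.* (⅔ ℚ.* p) ≡ ⅔ ℚ.* (⅓ ℚ.* p)
⅔*-comm p = trans (sym (ℚₚ.*-assoc ⅓ ⅔ p)) (ℚₚ.*-assoc ⅔ ⅓ p)

-- Self-similarity: the gap between 3⁻ⁿ/3 and 2·3⁻ⁿ/3 is the middle gap contracted n times by 1/3. A
-- point of the right part is at least 2/3, hence beyond the gap; a point y/3 of the left part
-- passes the claim to y at the previous scale.
cantor-gap : ∀ n x → x ∈ CantorStage (suc n) →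
             ¬ fromℚ (⅔ ℚ.* ⅓^ n) ≤ x → x ≤ fromℚ (⅓ ℚ.* ⅓^ n)
cantor-gap n x (y , y∈ , inj₂ x≈) x≱ = contradiction
  (≤-trans (fromℚ (⅔ ℚ.* ⅓^ n)) 2/3ℝ x
    (fromℚ-mono (ℚₚ.*-monoˡ-≤-nonNeg ⅔ (⅓^-≤1 n)))
    (right-part-≥⅔ n x y y∈ x≈))
  x≱
cantor-gap zero x (y , (_ , y≤1) , inj₁ x≈) x≱ =
  ≤-trans x (1/3ℝ * y) 1/3ℝ (≈⇒≤ x (1/3ℝ * y) x≈) (fromℚ-*-mono ⅓ y 1ℝ 0<⅓ y≤1)
cantor-gap (suc n) x (y , y∈ , inj₁ x≈) x≱ =
  ≤-trans x (1/3ℝ * y) (fromℚ (⅓ ℚ.* ⅓^ suc n)) (≈⇒≤ x (1/3ℝ * y) x≈)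
    (fromℚ-*-mono ⅓ y (fromℚ (⅓ ℚ.* ⅓^ n)) 0<⅓ (cantor-gap n y y∈ y≱))
  where
  y≱ : ¬ fromℚ (⅔ ℚ.* ⅓^ n) ≤ y
  y≱ ≤y = x≱ (≤-trans (fromℚ (⅔ ℚ.* ⅓^ suc n)) (1/3ℝ * y) x
    (subst (λ p → fromℚ p ≤ 1/3ℝ * y) (⅔*-comm (⅓^ n))
      (fromℚ-*-mono ⅓ (fromℚ (⅔ ℚ.* ⅓^ n)) y 0<⅓ ≤y))
    (≈⇒≥ x (1/3ℝ * y) x≈))

-- 0 is fixed by y ↦ y/3, so it is its own preimage at every stage.
0∈C : 0ℝ ∈ C
0∈C zero    = fromℚ-mono (ℚₚ.≤-refl {0ℚ}) , fromℚ-mono (ℚₚ.nonNegative⁻¹ 1ℚ)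
0∈C (suc n) = 0ℝ , 0∈C n , inj₁ (seq-≡⇒≈ 0ℝ (1/3ℝ * 0ℝ) (always λ _ → refl))

-- 1 is fixed by y ↦ 2/3 + y/3.
1∈C : 1ℝ ∈ C
1∈C zero    = fromℚ-mono (ℚₚ.nonNegative⁻¹ 1ℚ) , fromℚ-mono (ℚₚ.≤-refl {1ℚ})
1∈C (suc n) = 1ℝ , 1∈C n , inj₂ (seq-≡⇒≈ 1ℝ (2/3ℝ + 1/3ℝ * 1ℝ) (always λ _ → refl))

-- This lets Black open with radius 1 = `⅓^ 0`; the distance 1 is realised by the endpoints.
1≤diameter : AtMostDiameter C 1ℝ
1≤diameter b h = h 1ℝ 0ℝ 1∈C 0∈C

-- Black's strategy

-- Only powers of 1/3 occur as radii, so that `cantor-gap` applies at the scale of the ball.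
ballAt0 : ℕ → Ball C
ballAt0 j = record
  { centre   = 0ℝ
  ; radius   = fromℚ (⅓^ j)
  ; centre∈K = 0∈C
  -- `_<_` demands a margin that itself leaves a strict inequality, hence half the radius.
  ; radius>0 = ⅓^ j ℚ.* ½ , half-pos (⅓^-pos j) , always λ _ →
      subst₂ ℚ._<_ (sym (ℚₚ.+-identityˡ (⅓^ j ℚ.* ½))) (ε½+ε½≡ε (⅓^ j))
        (p<p+ε (⅓^ j ℚ.* ½) (half-pos (⅓^-pos j)))
  }

-- The outcome 0 is not badly approximable

lower-bound : ∀ x c {ε} → Eventually (λ n → 0ℚ ℚ.+ ε ℚ.< seq c n) →
              c * 1ℝ < ∣ x * 1ℝ - 0ℝ ∣ → fromℚ ε ≤ ∣ x - 0ℝ ∣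
lower-bound x c {ε} ε<c (δ , 0<δ , c+δ<x) =
  seq-≤⇒≤ (fromℚ ε) ∣ x - 0ℝ ∣ (zipWith lower ε<c c+δ<x)
  where
  open ℚₚ.≤-Reasoning
  lower : ∀ n → 0ℚ ℚ.+ ε ℚ.< seq c n →
          seq c n ℚ.* 1ℚ ℚ.+ δ ℚ.< ℚ.∣ seq x n ℚ.* 1ℚ ℚ.- 0ℚ ∣ →
          ε ℚ.≤ ℚ.∣ seq x n ℚ.- 0ℚ ∣
  lower n ε<cn cn+δ<xn = ℚₚ.<⇒≤ (begin-strict
    ε                              ≡⟨ sym (ℚₚ.+-identityˡ ε) ⟩
    0ℚ ℚ.+ ε                       <⟨ ε<cn ⟩
    seq c n                        ≡⟨ sym (ℚₚ.*-identityʳ (seq c n)) ⟩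
    seq c n ℚ.* 1ℚ                 <⟨ p<p+ε (seq c n ℚ.* 1ℚ) 0<δ ⟩
    seq c n ℚ.* 1ℚ ℚ.+ δ           <⟨ cn+δ<xn ⟩
    ℚ.∣ seq x n ℚ.* 1ℚ ℚ.- 0ℚ ∣    ≡⟨ cong (λ t → ℚ.∣ t ℚ.- 0ℚ ∣) (ℚₚ.*-identityʳ (seq x n)) ⟩
    ℚ.∣ seq x n ℚ.- 0ℚ ∣           ∎)

-- For the multiplier 1 and the integer 0 the approximation condition says |x| > c, and c exceeds
-- the rational ε that witnesses its positivity.
BA⇒nonzero : ∀ x → x ∈ BA → ∃[ ε ] (0ℚ ℚ.< ε × fromℚ ε ≤ ∣ x - 0ℝ ∣)
BA⇒nonzero x (c , (ε , 0<ε , ε<c) , approx) =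
  ε , 0<ε , lower-bound x c ε<c (approx (ℤ.+ 1) (ℤ.+ 0))

-- Some power of 1/3 is at most ε/2, which would give ε ≤ x ≤ ε/2.
≤⅓^⇒≯0 : ∀ x → (∀ n → x ≤ fromℚ (⅓^ n)) → ∀ ε → 0ℚ ℚ.< ε → ¬ fromℚ ε ≤ x
≤⅓^⇒≯0 x x≤ ε 0<ε ε≤x = go (⅓^-archimedean (ε ℚ.* ½) (half-pos 0<ε))
  where
  go : ¬ (∃[ n ] ⅓^ n ℚ.≤ ε ℚ.* ½)
  go (n , ⅓^n≤ε½) = ℚₚ.<-irrefl refl (begin-strict
    ε ℚ.* ½    <⟨ subst (ε ℚ.* ½ ℚ.<_) (ε½+ε½≡ε ε) (p<p+ε (ε ℚ.* ½) (half-pos 0<ε)) ⟩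
    ε          ≤⟨ fromℚ-cancel (≤-trans (fromℚ ε) x (fromℚ (⅓^ n)) ε≤x (x≤ n)) ⟩
    ⅓^ n       ≤⟨ ⅓^n≤ε½ ⟩
    ε ℚ.* ½    ∎)
    where open ℚₚ.≤-Reasoning

0-not-BA : ∀ x → (∀ n → ∣ x - 0ℝ ∣ ≤ fromℚ (⅓^ n)) → ¬ x ∈ BA
0-not-BA x x≤ x∈BA =
  let ε , 0<ε , ε≤∣x∣ = BA⇒nonzero x x∈BA
  in ≤⅓^⇒≯0 ∣ x - 0ℝ ∣ x≤ ε 0<ε ε≤∣x∣

-- One round of the game when α exceeds 1/3 by a rational margin ε

module _ (α : ℝ) (ε : ℚ) (0<ε : 0ℚ ℚ.< ε)
         (⅓+ε<α : Eventually (λ n → ⅓ ℚ.+ ε ℚ.< seq α n)) where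

  [⅓+ε]s≤α*s : ∀ j → fromℚ ((⅓ ℚ.+ ε) ℚ.* ⅓^ j) ≤ α * fromℚ (⅓^ j)
  [⅓+ε]s≤α*s j = seq-≤⇒≤ (fromℚ ((⅓ ℚ.+ ε) ℚ.* ⅓^ j)) (α * fromℚ (⅓^ j))
    (map (λ n h → ℚₚ.*-monoʳ-≤-nonNeg (⅓^ j) {{ℚ.nonNegative (ℚₚ.<⇒≤ (⅓^-pos j))}} (ℚₚ.<⇒≤ h))
      ⅓+ε<α)

  module _ (j : ℕ) (W : Ball C) (W⊆ : ⟦ W ⟧ ⊆ ⟦ ballAt0 j ⟧)
           (r≈ : radius W ≈ α * fromℚ (⅓^ j)) where

    private
      c r : ℝ
      c = centre W
      r = radius W

    radius-lower : fromℚ ((⅓ ℚ.+ ε) ℚ.* ⅓^ j) ≤ r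
    radius-lower = ≤-trans (fromℚ ((⅓ ℚ.+ ε) ℚ.* ⅓^ j)) (α * fromℚ (⅓^ j)) r
      ([⅓+ε]s≤α*s j) (≈⇒≥ r (α * fromℚ (⅓^ j)) r≈)

    -- Balls are compared as subsets of ℝ, so containment may be tested at the right endpoint even
    -- if it lies outside C.
    right-end∈W : c + r ∈ ⟦ W ⟧
    right-end∈W = seq-≤⇒≤ ∣ (c + r) - c ∣ r (map
      -- Terms of the radius are eventually positive, hence equal to their absolute values.
      (λ n δ<r → ℚₚ.≤-reflexive (trans (cong ℚ.∣_∣ ([p+q]-p≡q (seq c n) (seq r n)))
        (ℚₚ.0≤p⇒∣p∣≡p (ℚₚ.<⇒≤ (ℚₚ.<-trans (p<p+ε 0ℚ (proj₁ (proj₂ (radius>0 W)))) δ<r)))))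
      (proj₂ (proj₂ (radius>0 W))))
      where
      [p+q]-p≡q : ∀ p q → (p ℚ.+ q) ℚ.- p ≡ q
      [p+q]-p≡q = solve-∀ ℚ-ring

    right-end≤ : c + r ≤ fromℚ (⅓^ j)
    right-end≤ = ≤-trans (c + r) ∣ (c + r) - 0ℝ ∣ (fromℚ (⅓^ j))
      (seq-≤⇒≤ (c + r) ∣ (c + r) - 0ℝ ∣ (always λ n →
        subst (λ t → seq c n ℚ.+ seq r n ℚ.≤ ℚ.∣ t ∣)
          (sym (ℚₚ.+-identityʳ (seq c n ℚ.+ seq r n)))
          (p≤∣p∣ (seq c n ℚ.+ seq r n))))
      (W⊆ {c + r} right-end∈W)

    -- With s = `⅓^ j`, a centre at or beyond 2s/3 and a radius of at least (1/3 + ε)s would put the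
    -- right endpoint beyond s; the gap of C then leaves only c ≤ s/3.
    centre-upper : c ≤ fromℚ (⅓ ℚ.* ⅓^ j)
    -- The gap at scale 3⁻ʲ opens only at stage j + 1.
    centre-upper = cantor-gap j c (centre∈K W (suc j)) λ ⅔s≤c →
      ℚₚ.<-irrefl refl (ℚₚ.<-≤-trans s<⅔s+[⅓+ε]s (fromℚ-cancel
        (≤-trans (fromℚ (⅔ ℚ.* ⅓^ j) + fromℚ ((⅓ ℚ.+ ε) ℚ.* ⅓^ j)) (c + r) (fromℚ (⅓^ j))
          (+-mono-≤ (fromℚ (⅔ ℚ.* ⅓^ j)) c (fromℚ ((⅓ ℚ.+ ε) ℚ.* ⅓^ j)) r ⅔s≤c radius-lower)
          right-end≤)))
      where
      open ℚₚ.≤-Reasoning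
      s<⅔s+[⅓+ε]s : ⅓^ j ℚ.< ⅔ ℚ.* ⅓^ j ℚ.+ (⅓ ℚ.+ ε) ℚ.* ⅓^ j
      s<⅔s+[⅓+ε]s = begin-strict
        ⅓^ j                                   ≡⟨ sym (ℚₚ.*-identityˡ (⅓^ j)) ⟩
        1ℚ ℚ.* ⅓^ j                            <⟨ ℚₚ.*-monoˡ-<-pos (⅓^ j) {{ℚ.positive (⅓^-pos j)}} (p<p+ε 1ℚ 0<ε) ⟩
        ((⅔ ℚ.+ ⅓) ℚ.+ ε) ℚ.* ⅓^ j             ≡⟨ cong (ℚ._* ⅓^ j) (ℚₚ.+-assoc ⅔ ⅓ ε) ⟩
        (⅔ ℚ.+ (⅓ ℚ.+ ε)) ℚ.* ⅓^ j             ≡⟨ ℚₚ.*-distribʳ-+ (⅓^ j) ⅔ (⅓ ℚ.+ ε) ⟩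
        ⅔ ℚ.* ⅓^ j ℚ.+ (⅓ ℚ.+ ε) ℚ.* ⅓^ j      ∎

    -- With s = `⅓^ j` and q = `⅓^ m`: |z - c| ≤ |z| + |c| ≤ qs + s/3 ≤ (1/3 + ε)s ≤ r.
    ballAt0⊆W : ∀ m → ⅓^ m ℚ.≤ ε → ⟦ ballAt0 (m ℕ.+ j) ⟧ ⊆ ⟦ W ⟧
    ballAt0⊆W m q≤ε {z} z∈ = ≤-trans (∣ z - c ∣) (∣ z - 0ℝ ∣ + ∣ c ∣) r
      (∣x-y∣≤∣x-0∣+∣y∣ z c)
      (≤-trans (∣ z - 0ℝ ∣ + ∣ c ∣) (fromℚ (⅓^ (m ℕ.+ j) ℚ.+ ⅓ ℚ.* ⅓^ j)) r
        (+-mono-≤ (∣ z - 0ℝ ∣) (fromℚ (⅓^ (m ℕ.+ j))) (∣ c ∣) (fromℚ (⅓ ℚ.* ⅓^ j)) z∈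
          (≤-trans (∣ c ∣) c (fromℚ (⅓ ℚ.* ⅓^ j))
            (∣x∣≤x c (stage-nonneg 0 c (centre∈K W 0))) centre-upper))
        (≤-trans (fromℚ (⅓^ (m ℕ.+ j) ℚ.+ ⅓ ℚ.* ⅓^ j)) (fromℚ ((⅓ ℚ.+ ε) ℚ.* ⅓^ j)) r
          (fromℚ-mono qs+⅓s≤[⅓+ε]s) radius-lower))
      where
      open ℚₚ.≤-Reasoning
      qs+⅓s≤[⅓+ε]s : ⅓^ (m ℕ.+ j) ℚ.+ ⅓ ℚ.* ⅓^ j ℚ.≤ (⅓ ℚ.+ ε) ℚ.* ⅓^ j
      qs+⅓s≤[⅓+ε]s = begin
        ⅓^ (m ℕ.+ j) ℚ.+ ⅓ ℚ.* ⅓^ j        ≡⟨ cong (ℚ._+ ⅓ ℚ.* ⅓^ j) (⅓^-+ m j) ⟩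
        ⅓^ m ℚ.* ⅓^ j ℚ.+ ⅓ ℚ.* ⅓^ j       ≡⟨ sym (ℚₚ.*-distribʳ-+ (⅓^ j) (⅓^ m) ⅓) ⟩
        (⅓^ m ℚ.+ ⅓) ℚ.* ⅓^ j
          ≤⟨ ℚₚ.*-monoʳ-≤-nonNeg (⅓^ j) {{ℚ.nonNegative (ℚₚ.<⇒≤ (⅓^-pos j))}} (ℚₚ.+-monoˡ-≤ ⅓ q≤ε) ⟩
        (ε ℚ.+ ⅓) ℚ.* ⅓^ j                 ≡⟨ cong (ℚ._* ⅓^ j) (ℚₚ.+-comm ε ⅓) ⟩
        (⅓ ℚ.+ ε) ℚ.* ⅓^ j                 ∎

  -- Black's play against a supposed winning strategy, with βα = 3⁻ᵐ

  module _ (β : ℝ) (m : ℕ) .{{_ : ℕ.NonZero m}} (⅓^m≤ε : ⅓^ m ℚ.≤ ε)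
           (βα≈⅓^m : ∀ s → fromℚ (⅓^ m ℚ.* s) ≈ β * (α * fromℚ s))
           (white : WinningStrategy C (C ∩ BA) α β) where

    open WinningStrategy white

    U : ℕ → Ball C
    U k = ballAt0 (k ℕ.* m)

    -- The radii match because β(α3⁻ʲ) = 3⁻ᵐ3⁻ʲ, and `suc n ℕ.* m` computes to `m ℕ.+ n ℕ.* m`, the
    -- exponent of the next ball.
    black-move : ∀ n → LegalMove α (U n) (reply σ U n) →
                 LegalMove β (reply σ U n) (U (suc n))
    black-move n (W⊆U , r≈) =
        (λ {z} → ballAt0⊆W j W (λ {z} → W⊆U {z}) r≈ m ⅓^m≤ε {z})
      , subst (λ p → fromℚ p ≈ β * radius W) (sym (⅓^-+ m j))
          (≈-trans (fromℚ (⅓^ m ℚ.* ⅓^ j)) (β * (α * fromℚ (⅓^ j))) (β * radius W)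
            (βα≈⅓^m (⅓^ j))
            (*-congˡ β (α * fromℚ (⅓^ j)) (radius W)
              (≈-sym (radius W) (α * fromℚ (⅓^ j)) r≈)))
      where
      j : ℕ
      j = n ℕ.* m
      W : Ball C
      W = reply σ U n

    -- White's reply is known to be legal only while Black has been legal, so the two alternate in
    -- the induction.
    U-legal : ∀ n → BlackLegal β σ U n
    U-legal zero    = 1≤diameter
    U-legal (suc n) = U-legal n , black-move n (legal U n (U-legal n))

    -- Since m ≥ 1 gives k ≤ km, the radii are dominated by 3⁻ᵏ and the outcome is forced to 0.
    ⅓^km≤⅓^k : ∀ k → ⅓^ (k ℕ.* m) ℚ.≤ ⅓^ k
    ⅓^km≤⅓^k k = subst (λ t → ⅓^ t ℚ.≤ ⅓^ k) (ℕₚ.m∸n+n≡m (ℕₚ.m≤m*n k m))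
      (⅓^-anti (k ℕ.* m ℕ.∸ k) k)

    outcome∉BA : ¬ (∃[ x ] ((∀ k → x ∈ ⟦ U k ⟧) × x ∈ C ∩ BA))
    outcome∉BA (x , x∈U , _ , x∈BA) = 0-not-BA x
      (λ k → ≤-trans ∣ x - 0ℝ ∣ (radius (U k)) (fromℚ (⅓^ k)) (x∈U k) (fromℚ-mono (⅓^km≤⅓^k k)))
      x∈BA

    white-loses : ⊥
    white-loses = outcome∉BA (wins U U-legal)

  -- The choice of β

  ⅓≤α : Eventually (λ n → ⅓ ℚ.≤ seq α n)
  ⅓≤α = map (λ n h → ℚₚ.<⇒≤ (ℚₚ.<-trans (p<p+ε ⅓ 0<ε) h)) ⅓+ε<α

  open Reciprocal α ⅓≤α

  -- Black's ratio β, chosen so that a full round shrinks the radius by exactly q.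
  q/α : ℚ → ℝ
  q/α q = fromℚ q * mkℝ inv inv-cauchy

  1≤inv : ∀ n → seq α n ℚ.≤ 1ℚ → seq α n ℚ.* inv n ≡ 1ℚ → 1ℚ ℚ.≤ inv n
  1≤inv n α≤1 α*inv≡1 = subst₂ ℚ._≤_ α*inv≡1 (ℚₚ.*-identityˡ (inv n))
    (ℚₚ.*-monoʳ-≤-nonNeg (inv n) {{ℚ.nonNegative (inv-≥0 n)}} α≤1)

  -- As α < 1, the reciprocal is eventually at least 1, so q/2 is a valid margin.
  0<q/α : ∀ q → 0ℚ ℚ.< q → α < 1ℝ → 0ℝ < q/α q
  0<q/α q 0<q (δ , 0<δ , α+δ<1) = q ℚ.* ½ , half-pos 0<q , zipWith lower α+δ<1 x*inv≡1
    where
    open ℚₚ.≤-Reasoning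
    lower : ∀ n → seq α n ℚ.+ δ ℚ.< 1ℚ → seq α n ℚ.* inv n ≡ 1ℚ →
            0ℚ ℚ.+ q ℚ.* ½ ℚ.< q ℚ.* inv n
    lower n α+δ<1 α*inv≡1 = begin-strict
      0ℚ ℚ.+ q ℚ.* ½          ≡⟨ ℚₚ.+-identityˡ (q ℚ.* ½) ⟩
      q ℚ.* ½                 <⟨ p<p+ε (q ℚ.* ½) (half-pos 0<q) ⟩
      q ℚ.* ½ ℚ.+ q ℚ.* ½     ≡⟨ trans (ε½+ε½≡ε q) (sym (ℚₚ.*-identityʳ q)) ⟩
      q ℚ.* 1ℚ                ≤⟨ ℚₚ.*-monoˡ-≤-nonNeg q {{ℚ.nonNegative (ℚₚ.<⇒≤ 0<q)}}
                                   (1≤inv n (ℚₚ.<⇒≤ (ℚₚ.<-trans (p<p+ε (seq α n) 0<δ) α+δ<1)) α*inv≡1) ⟩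
      q ℚ.* inv n             ∎

  -- Here q ≤ 1/9 and the reciprocal is at most 3, so the ratio is at most 1/3; a margin of 1/3
  -- still leaves 2/3 < 1.
  q/α<1 : ∀ m → q/α (⅓^ (2 ℕ.+ m)) < 1ℝ
  q/α<1 m = ⅓ , 0<⅓ , always λ n → begin-strict
    q ℚ.* inv n ℚ.+ ⅓
      ≤⟨ ℚₚ.+-monoˡ-≤ ⅓ (ℚₚ.*-monoˡ-≤-nonNeg q {{ℚ.nonNegative (ℚₚ.<⇒≤ (⅓^-pos (2 ℕ.+ m)))}} (inv-≤3 n)) ⟩
    q ℚ.* fromℕ 3 ℚ.+ ⅓
      ≤⟨ ℚₚ.+-monoˡ-≤ ⅓ (ℚₚ.*-monoʳ-≤-nonNeg (fromℕ 3) (⅓*-mono (⅓*-mono (⅓^-≤1 m)))) ⟩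
    ⅔
      <⟨ toWitness {a? = ⅔ ℚₚ.<? 1ℚ} tt ⟩
    1ℚ ∎
    where
    open ℚₚ.≤-Reasoning
    q = ⅓^ (2 ℕ.+ m)

  q/α-*-α : ∀ q s → fromℚ (q ℚ.* s) ≈ q/α q * (α * fromℚ s)
  q/α-*-α q s = seq-≡⇒≈ (fromℚ (q ℚ.* s)) (q/α q * (α * fromℚ s)) (map
    (λ n α*inv≡1 → sym (trans (rearrange q (inv n) (seq α n) s)
      (trans (cong (ℚ._* (q ℚ.* s)) α*inv≡1) (ℚₚ.*-identityˡ (q ℚ.* s)))))
    x*inv≡1)
    where
    rearrange : ∀ q i a s → (q ℚ.* i) ℚ.* (a ℚ.* s) ≡ (a ℚ.* i) ℚ.* (q ℚ.* s)
    rearrange = solve-∀ ℚ-ring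

-- Bounding the winning dimension

winning-≯⅓ : ∀ α → α ∈ WinningParameter C (C ∩ BA) → ¬ 1/3ℝ < α
winning-≯⅓ α ((_ , α<1) , winning) (ε , 0<ε , ⅓+ε<α) =
  white-loses α ε 0<ε ⅓+ε<α β (2 ℕ.+ m) q≤ε (q/α-*-α α ε 0<ε ⅓+ε<α q)
    (winning β
      (0<q/α α ε 0<ε ⅓+ε<α q (⅓^-pos (2 ℕ.+ m)) α<1 , q/α<1 α ε 0<ε ⅓+ε<α m))
  where
  m : ℕ
  m = proj₁ (⅓^-archimedean ε 0<ε)

  q : ℚ
  -- The two extra factors 1/3 keep β below 1 and make the exponent nonzero.
  q = ⅓^ (2 ℕ.+ m)

  q≤ε : q ℚ.≤ ε
  q≤ε = ℚₚ.≤-trans (⅓^-anti 2 m) (proj₂ (⅓^-archimedean ε 0<ε))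

  β : ℝ
  β = q/α α ε 0<ε ⅓+ε<α q

1/3-upperBound : UpperBound (WinningParameter C (C ∩ BA)) 1/3ℝ
1/3-upperBound α α-winning = ≯fromℚ⇒≤fromℚ α ⅓ (winning-≯⅓ α α-winning)

-- No case distinction on the existence of a winning parameter is made. Supposing d > 1/3 rules out
-- d ≈ 0, hence also the absence of parameters; then d is a least upper bound and cannot exceed the
-- upper bound 1/3.
windim≤1/3 : ∀ d → Windim C (C ∩ BA) d → d ≤ 1/3ℝ
windim≤1/3 d (none⇒d≈0 , some⇒lub) = ≯fromℚ⇒≤fromℚ d ⅓ λ ⅓<d →
  let d≰⅓  = <⇒≱ 1/3ℝ d ⅓<d
      some = λ none → d≰⅓ (≤-trans d 0ℝ 1/3ℝ (≈⇒≤ d 0ℝ (none⇒d≈0 none))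
               (fromℚ-mono (ℚₚ.nonNegative⁻¹ ⅓)))
  in d≰⅓ (proj₂ (some⇒lub some) 1/3ℝ 1/3-upperBound)

-- The least upper bound need not exist constructively, so the bound on all winning parameters is
-- recorded alongside.
proposition4 : (∀ d → Windim C (C ∩ BA) d → d ≤ 1/3ℝ)
    × UpperBound (WinningParameter C (C ∩ BA)) 1/3ℝ
proposition4 = windim≤1/3 , 1/3-upperBound
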